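{- Let $P$ be a self-dual word over $\{+,-,*\}$ of length at least $3$ that contains at least two occurrences of $*$. Then the cycle $\mathbb{G}=C(P\,+)$ is Słupecki.
   Context: All digraphs are reflexive. A $k$-ary polymorphism of a digraph $\mathbb{G}$ is a homomorphism (arc-preserving map) $\mathbb{G}^k\to\mathbb{G}$, where $\mathbb{G}^k$ is the usual (coordinatewise) power; it is essentially unary if there exist $1\le i\le k$ and a homomorphism $g:\mathbb{G}\to\mathbb{G}$ with $f(x_1,\dots,x_k)=g(x_i)$ for all $x_1,\dots,x_k$. $\mathbb{G}$ is Słupecki if all its surjective polymorphisms (of all arities $k\ge 1$) are essentially unary. For a word $W=x_1\cdots x_k$ over $\{+,-,*\}$, $\overline{W}=\overline{x_k}\cdots\overline{x_1}$ with $\overline{+}=-$, $\overline{ - }=+$, $\overline{*}=*$; $W$ is self-dual if $W=\overline{W}$. For $k\ge 3$, $C(W)$ is the reflexive digraph with vertex set $\{0,\dots,k-1\}$ (indices mod $k$) in which, for $1\le i\le k$, between $i-1$ and $i$ there is exactly the arc $(i-1,i)$ if $x_i=+$, exactly the arc $(i,i-1)$ if $x_i=-$, and both arcs if $x_i=*$, and there are no other arcs besides loops. $P\,+$ denotes the word $P$ followed by the letter $+$. -}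

module Defs where

open import Data.Fin using (Fin; toℕ)
open import Data.Fin.Properties using (nonZeroIndex)
open import Data.Nat using (ℕ; suc; _≤_)
open import Data.Nat.DivMod using (_mod_)
open import Data.Product using (_×_; ∃-syntax)
open import Data.Sum using (_⊎_; inj₁)
open import Data.Vec using (Vec; lookup; map; reverse)
open import Data.Vec.Relation.Binary.Pointwise.Inductive as Pointwise using (Pointwise)
open import Function.Definitions using (StrictlySurjective)
open import Relation.Binary.Core using (Rel; _Preserves_⟶_)
open import Relation.Binary.Definitions using (Reflexive; DecidableEquality)
open import Relation.Binary.PropositionalEquality using (_≡_; refl)
open import Relation.Nullary using (yes; no)
open import Level using (0ℓ)

record ReflexiveDigraph : Set₁ where
  field
    Vertex    : Set
    Arc       : Rel Vertex 0ℓ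
    reflexive : Reflexive Arc

open ReflexiveDigraph

IsHomomorphism : (G H : ReflexiveDigraph) → (Vertex G → Vertex H) → Set
IsHomomorphism G H f = f Preserves Arc G ⟶ Arc H

Power : ReflexiveDigraph → ℕ → ReflexiveDigraph
Power G k = record
  { Vertex    = Vec (Vertex G) k
  ; Arc       = Pointwise (Arc G)
  ; reflexive = Pointwise.refl (reflexive G)
  }

IsPolymorphism : (G : ReflexiveDigraph) {k : ℕ} → (Vec (Vertex G) k → Vertex G) → Set
IsPolymorphism G {k} f = IsHomomorphism (Power G k) G f

EssentiallyUnary : (G : ReflexiveDigraph) {k : ℕ} → (Vec (Vertex G) k → Vertex G) → Set
EssentiallyUnary G {k} f =
  ∃[ i ] ∃[ g ] (IsHomomorphism G G g × (∀ (xs : Vec (Vertex G) k) → f xs ≡ g (lookup xs i)))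

Słupecki : ReflexiveDigraph → Set
Słupecki G =
  ∀ (k : ℕ) → 1 ≤ k → (f : Vec (Vertex G) k → Vertex G) →
  IsPolymorphism G f → StrictlySurjective _≡_ f → EssentiallyUnary G f

data Letter : Set where
  + - * : Letter

_≟_ : DecidableEquality Letter
+ ≟ + = yes refl
+ ≟ - = no λ ()
+ ≟ * = no λ ()
- ≟ + = no λ ()
- ≟ - = yes refl
- ≟ * = no λ ()
* ≟ + = no λ ()
* ≟ - = no λ ()
* ≟ * = yes refl

Word : ℕ → Set
Word = Vec Letter

opposite : Letter → Letter
opposite + = -
opposite - = +
opposite * = *

dual : ∀ {k} → Word k → Word k
dual W = reverse (map opposite W)

SelfDual : ∀ {k} → Word k → Set
SelfDual W = W ≡ dual W

data HasForward : Letter → Set where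
  plus : HasForward +
  star : HasForward *

data HasBackward : Letter → Set where
  minus : HasBackward -
  star  : HasBackward *

next : ∀ {k} → Fin k → Fin k
next {k} i = (suc (toℕ i) mod k) {{nonZeroIndex i}}

-- `lookup W i` is the (i+1)-st letter of W, so it governs the arcs between i
-- and next i.  The definition makes sense for every length, but it is a cycle
-- with each edge described by exactly one letter only for k ≥ 3.
CArc : ∀ {k} → Word k → Rel (Fin k) 0ℓ
CArc W u v =
    u ≡ v
  ⊎ (v ≡ next u × HasForward (lookup W u))
  ⊎ (u ≡ next v × HasBackward (lookup W v))

C : ∀ {k} → Word k → ReflexiveDigraph
C {k} W = record
  { Vertex    = Fin k
  ; Arc       = CArc W
  ; reflexive = inj₁ refl
  }

{-# OPTIONS --safe #-}
module Submission where

-- A polymorphism f : G^k → G is treated as a map of covering spaces, with ℕ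
-- (residues mod n + 1) standing for the universal cover of the cycle.  By
-- induction on k, lift the slice x₁ = 0 and drag the lift once around the first
-- coordinate.  If it comes back to itself, f lifts; otherwise it is displaced by
-- a full turn, so one line is mapped by an automorphism, and rigidity of the
-- identity makes every parallel line agree with it: f is essentially unary.
--
-- A lift F is incompatible with surjectivity.  Let F attain its minimum a at x.
-- The letters of the n - 1 edges above a determine a sequence of arc directions
-- along which F can rise by at most n - 1.  In G, however, any vertex can be
-- joined to any other by a walk with these directions: charging 1 for a two-way
-- and 2 for a one-way edge, each letter is worth a unit to every walker, which is
-- enough for the upward and the downward walk together to go round the cycle.
-- So all tuples are reachable from x, and f misses the residue of a + n.

open import Defs renaming (+ to fwd; - to bwd; * to bi) hiding (_≟_)
open import Data.Nat using (ℕ; zero; suc; _+_; _*_; _∸_; pred; _≤_; _<_; z≤n; s≤s; >-nonZero)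
open import Data.Nat.Properties hiding (_≟_)
open import Data.Nat.DivMod using (_mod_; _%_; _/_; m≡m%n+[m/n]*n; m%n<n; [m+n]%n≡m%n; [m+kn]%n≡m%n; m<n⇒m%n≡m; %-distribˡ-+; m%n%n≡m%n)
open import Data.Fin as Fin using (Fin; toℕ)
open import Data.Fin.Properties as Fin using (toℕ-injective; toℕ-fromℕ<; toℕ<n)
open import Data.Product using (_×_; _,_; proj₁; proj₂; ∃; ∃-syntax)
open import Data.Sum using (_⊎_; inj₁; inj₂; swap)
open import Data.Vec using (Vec; []; _∷_; lookup; count; replicate; _∷ʳ_; _[_]≔_)
open import Data.Vec.Properties using ([]≔-lookup; lookup∘updateAt)
open import Data.Vec.Relation.Binary.Pointwise.Inductive as Pointwise using (Pointwise; []; _∷_)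
open import Data.Nat.GeneralisedArithmetic using (fold)
open import Data.Bool using (Bool; true; false; not; if_then_else_)
open import Data.List using (List; []; _∷_; length)
open import Data.Nat.Induction using (<-rec)
open import Data.Empty using (⊥-elim)
open import Function using (_∘_; flip)
open import Function.Definitions using (StrictlySurjective)
open import Level using (0ℓ)
open import Relation.Binary.Core using (Rel)
open import Relation.Binary.PropositionalEquality
open import Relation.Nullary using (Dec; ¬_; from-yes; yes; no; contradiction)

-- Residues modulo n + 1 and rigidity of the identity

Within : ℕ → Rel ℕ 0ℓ
Within k i j = i ≤ k + j × j ≤ k + i

within-sym : ∀ {k i j} → Within k i j → Within k j i
within-sym (p , q) = q , p

within-trans : ∀ {k l i j h} → Within k i j → Within l j h → Within (k + l) i h
within-trans {k} {l} {i} {j} {h} (p , q) (p′ , q′) = chain p p′ , subst (λ e → h ≤ e + i) (+-comm l k) (chain q′ q)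
  where
  chain : ∀ {k l i j h} → i ≤ k + j → j ≤ l + h → i ≤ k + l + h
  chain {k} {l} {i} {j} {h} p p′ = begin
    i           ≤⟨ p ⟩
    k + j       ≤⟨ +-monoʳ-≤ k p′ ⟩
    k + (l + h) ≡⟨ sym (+-assoc k l h) ⟩
    k + l + h   ∎
    where open ≤-Reasoning

module CyclicOrder (n : ℕ) where

  π : ℕ → Fin (suc n)
  π i = i mod suc n

  toℕ-π : ∀ i → toℕ (π i) ≡ i % suc n
  toℕ-π i = toℕ-fromℕ< (m%n<n i (suc n))

  π-cong-% : ∀ i j → i % suc n ≡ j % suc n → π i ≡ π j
  π-cong-% i j p = toℕ-injective (trans (toℕ-π i) (trans p (sym (toℕ-π j))))

  π-toℕ : ∀ v → π (toℕ v) ≡ v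
  π-toℕ v = toℕ-injective (trans (toℕ-π (toℕ v)) (m<n⇒m%n≡m (toℕ<n v)))

  π-+-toℕ : ∀ k i → π (k + toℕ (π i)) ≡ π (k + i)
  π-+-toℕ k i = π-cong-% (k + toℕ (π i)) (k + i) (begin
    (k + toℕ (π i)) % suc n                 ≡⟨ cong (λ j → (k + j) % suc n) (toℕ-π i) ⟩
    (k + i % suc n) % suc n                 ≡⟨ %-distribˡ-+ k (i % suc n) (suc n) ⟩
    (k % suc n + i % suc n % suc n) % suc n ≡⟨ cong (λ j → (k % suc n + j) % suc n) (m%n%n≡m%n i (suc n)) ⟩
    (k % suc n + i % suc n) % suc n         ≡⟨ %-distribˡ-+ k i (suc n) ⟨
    (k + i) % suc n                         ∎)
    where open ≡-Reasoning

  next-π : ∀ i → next (π i) ≡ π (suc i)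
  next-π = π-+-toℕ 1

  π-periodic : ∀ i k → π (i + k * suc n) ≡ π i
  π-periodic i k = π-cong-% (i + k * suc n) i ([m+kn]%n≡m%n i k (suc n))

  π-period : ∀ i → π (i + suc n) ≡ π i
  π-period i = π-cong-% (i + suc n) i ([m+n]%n≡m%n i (suc n))

  -- If the quotient of `j` exceeds that of `i`, equal remainders put `j` at least `suc n` above
  -- `i`; otherwise `j` is at most `i`.
  π-injective : ∀ {i j} → π i ≡ π j → i ≤ j → j < i + suc n → i ≡ j
  π-injective {i} {j} eq i≤j j<i+m with j / suc n ≤? i / suc n
  ... | yes q = ≤-antisym i≤j (begin
    j                                  ≡⟨ m≡m%n+[m/n]*n j (suc n) ⟩
    j % suc n + j / suc n * suc n      ≤⟨ +-monoʳ-≤ (j % suc n) (*-monoˡ-≤ (suc n) q) ⟩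
    j % suc n + i / suc n * suc n      ≡⟨ cong (_+ i / suc n * suc n) same ⟨
    i % suc n + i / suc n * suc n      ≡⟨ m≡m%n+[m/n]*n i (suc n) ⟨
    i                                  ∎)
    where
    open ≤-Reasoning
    same = trans (sym (toℕ-π i)) (trans (cong toℕ eq) (toℕ-π j))
  ... | no q = contradiction j<i+m (≤⇒≯ (begin
    i + suc n                                    ≡⟨ cong (_+ suc n) (m≡m%n+[m/n]*n i (suc n)) ⟩
    i % suc n + i / suc n * suc n + suc n        ≡⟨ +-assoc (i % suc n) _ (suc n) ⟩
    i % suc n + (i / suc n * suc n + suc n)      ≡⟨ cong (i % suc n +_) (+-comm _ (suc n)) ⟩
    i % suc n + suc (i / suc n) * suc n          ≡⟨ cong (_+ suc (i / suc n) * suc n) same ⟩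
    j % suc n + suc (i / suc n) * suc n          ≤⟨ +-monoʳ-≤ (j % suc n) (*-monoˡ-≤ (suc n) (≰⇒> q)) ⟩
    j % suc n + j / suc n * suc n                ≡⟨ m≡m%n+[m/n]*n j (suc n) ⟨
    j                                            ∎))
    where
    open ≤-Reasoning
    same = trans (sym (toℕ-π i)) (trans (cong toℕ eq) (toℕ-π j))

  prev : Fin (suc n) → Fin (suc n)
  prev v = π (n + toℕ v)

  prev-next : ∀ v → prev (next v) ≡ v
  prev-next v = begin
    π (n + toℕ (next v)) ≡⟨ cong (λ u → π (n + toℕ u)) (trans (cong next (sym (π-toℕ v))) (next-π (toℕ v))) ⟩
    π (n + toℕ (π (suc (toℕ v)))) ≡⟨ π-+-toℕ n (suc (toℕ v)) ⟩
    π (n + suc (toℕ v)) ≡⟨ cong π (trans (+-suc n (toℕ v)) (+-comm (suc n) (toℕ v))) ⟩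
    π (toℕ v + suc n)   ≡⟨ π-period (toℕ v) ⟩
    π (toℕ v)           ≡⟨ π-toℕ v ⟩
    v                   ∎
    where open ≡-Reasoning

  next-prev : ∀ v → next (prev v) ≡ v
  next-prev v = trans (next-π (n + toℕ v)) (trans (cong π (+-comm (suc n) (toℕ v))) (trans (π-period (toℕ v)) (π-toℕ v)))

  next-injective : ∀ {u v} → next u ≡ next v → u ≡ v
  next-injective {u} {v} eq = trans (sym (prev-next u)) (trans (cong prev eq) (prev-next v))

  Adj : Rel (Fin (suc n)) 0ℓ
  Adj u v = u ≡ v ⊎ v ≡ next u ⊎ u ≡ next v

  adj-sym : ∀ {u v} → Adj u v → Adj v u
  adj-sym (inj₁ p) = inj₁ (sym p)
  adj-sym (inj₂ (inj₁ p)) = inj₂ (inj₂ p)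
  adj-sym (inj₂ (inj₂ p)) = inj₂ (inj₁ p)

  module _ (3≤n : 3 ≤ n) where

    π-injective-near : ∀ {i j} → π i ≡ π j → Within 3 i j → i ≡ j
    π-injective-near {i} {j} eq (p , q) with ≤-total i j
    ... | inj₁ i≤j = π-injective eq i≤j (bound q)
      where
      bound : ∀ {i j} → j ≤ 3 + i → j < i + suc n
      bound {i} {j} q = ≤-trans (s≤s q) (subst (_≤ i + suc n) (+-comm i 4) (+-monoʳ-≤ i (s≤s 3≤n)))
    ... | inj₂ j≤i = sym (π-injective (sym eq) j≤i (≤-trans (s≤s p) (subst (_≤ j + suc n) (+-comm j 4) (+-monoʳ-≤ j (s≤s 3≤n)))))

    -- A cycle with at least four vertices has no adjacent vertices two apart. This is what
    -- continues a lift over an edge: two small steps bound a difference by 2, and adjacency of the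
    -- values improves the bound to 1.
    adj⇒near : ∀ {i j} → Adj (π i) (π j) → Within 2 i j → Within 1 i j
    adj⇒near {i} {j} (inj₁ eq) (p , q) with refl ← π-injective-near eq (m≤n⇒m≤1+n p , m≤n⇒m≤1+n q) = n≤1+n i , n≤1+n i
    adj⇒near {i} {j} (inj₂ (inj₁ eq)) (p , q)
      with refl ← π-injective-near (trans eq (next-π i)) (≤-trans q (m≤n+m _ 2) , s≤s p) = m≤n+m i 2 , ≤-refl
    adj⇒near {i} {j} (inj₂ (inj₂ eq)) (p , q)
      with refl ← π-injective-near (trans eq (next-π j)) (≤-trans p (m≤n+m _ 2) , s≤s q) = ≤-refl , m≤n+m j 2

    ¬adj-next² : ∀ u → ¬ Adj u (next (next u))
    ¬adj-next² u a = 1+n≰n (proj₂ (adj⇒near {toℕ u} {2 + toℕ u} a′ (m≤n+m (toℕ u) 4 , ≤-refl)))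
      where
      a′ : Adj (π (toℕ u)) (π (2 + toℕ u))
      a′ = subst₂ Adj (sym (π-toℕ u)) (trans (cong (next ∘ next) (sym (π-toℕ u))) (trans (cong next (next-π (toℕ u))) (next-π (suc (toℕ u))))) a

    -- The last hypothesis on `h` makes (identity, `h`) an arc of the digraph of homomorphisms; on
    -- loops it says that `h` moves each vertex by at most one. If `h v` is the successor of `v`,
    -- compare `v` with its predecessor, and if it is the predecessor, with its successor. Whichever
    -- way the edge between them points, some arc would join vertices two apart.
    rigid : (R : Rel (Fin (suc n)) 0ℓ) → (∀ {v} → R v v) → (∀ {u v} → R u v → Adj u v) →
            (∀ u → R u (next u) ⊎ R (next u) u) →
            (h : Fin (suc n) → Fin (suc n)) → (∀ {u v} → R u v → R (h u) (h v)) →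
            (∀ {u v} → R u v → R u (h v)) → ∀ v → h v ≡ v
    rigid R R-refl adj total h hom below v with adj (below (R-refl {v}))
    ... | inj₁ eq = sym eq
    ... | inj₂ (inj₁ up) = ⊥-elim (ascent (prev v) (trans (cong h (next-prev v)) (trans up (cong next (sym (next-prev v))))))
      where
      ascent : ∀ b → h (next b) ≢ next (next b)
      ascent b eq with total b
      ... | inj₁ b→b⁺ = ¬adj-next² b (subst (Adj b) eq (adj (below b→b⁺)))
      ... | inj₂ b⁺→b with adj (below (R-refl {b}))
      ...   | inj₁ b≡hb = ¬adj-next² b (adj-sym (subst₂ Adj eq (sym b≡hb) (adj (hom b⁺→b))))
      ...   | inj₂ (inj₁ hb≡b⁺) = ¬adj-next² b (subst (Adj b) eq (adj (below (subst (R b) hb≡b⁺ (below R-refl)))))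
      ...   | inj₂ (inj₂ b≡hb⁺) = ¬adj-next² (h b) (adj-sym (subst (λ u → Adj u (h b)) (cong next b≡hb⁺) (adj (below b⁺→b))))
    ... | inj₂ (inj₂ v≡hv⁺) = ⊥-elim (descent (total v))
      where
      v⁺≡hv⁺⁺ = cong next v≡hv⁺
      descent : ¬ (R v (next v) ⊎ R (next v) v)
      descent (inj₂ v⁺→v) = ¬adj-next² (h v) (adj-sym (subst (λ u → Adj u (h v)) v⁺≡hv⁺⁺ (adj (below v⁺→v))))
      descent (inj₁ v→v⁺) with adj (below (R-refl {next v}))
      ... | inj₁ v⁺≡hv⁺ = ¬adj-next² (h v) (subst (Adj (h v)) (trans (sym v⁺≡hv⁺) v⁺≡hv⁺⁺) (adj (hom v→v⁺)))
      ... | inj₂ (inj₁ hv⁺≡v⁺⁺) = ¬adj-next² v (subst (Adj v) hv⁺≡v⁺⁺ (adj (below v→v⁺)))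
      ... | inj₂ (inj₂ v⁺≡h[v⁺]⁺) = ¬adj-next² (h v) (adj-sym (subst (λ u → Adj u (h v)) v⁺≡hv⁺⁺
              (adj (below (subst (R (next v)) (sym (next-injective v⁺≡h[v⁺]⁺)) (below R-refl))))))

-- Sequences with steps of size at most one

climb : (g : ℕ → ℕ) → (∀ t → g (suc t) ≤ suc (g t)) → ∀ d t → g (d + t) ≤ d + g t
climb g step zero t = ≤-refl
climb g step (suc d) t = ≤-trans (step (d + t)) (s≤s (climb g step d t))

fall : (g : ℕ → ℕ) → (∀ t → g t ≤ suc (g (suc t))) → ∀ d t → g t ≤ d + g (d + t)
fall g step zero t = ≤-refl
fall g step (suc d) t = ≤-trans (fall g step d t) (≤-trans (+-monoʳ-≤ d (step (d + t))) (≤-reflexive (+-suc d (g (suc (d + t))))))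

-- The last `d` steps gain at most `d`, so a total gain of `d + t` needs the full gain `t` in the
-- first `t` steps.
steepest-climb : (g : ℕ → ℕ) → (∀ t → g (suc t) ≤ suc (g t)) → ∀ {d t} → g (d + t) ≡ d + t + g 0 → g t ≡ t + g 0
steepest-climb g step {d} {t} top = ≤-antisym (subst (λ s → g s ≤ t + g 0) (+-identityʳ t) (climb g step t 0))
  (+-cancelˡ-≤ d (t + g 0) (g t) (subst (_≤ d + g t) (trans top (+-assoc d t (g 0))) (climb g step d t)))

steepest-fall : (g : ℕ → ℕ) → (∀ t → g t ≤ suc (g (suc t))) → ∀ {d t} → g 0 ≡ d + t + g (d + t) → t + g t ≡ g 0
steepest-fall g step {d} {t} top = ≤-antisym
  (begin
    t + g t               ≤⟨ +-monoʳ-≤ t (fall g step d t) ⟩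
    t + (d + g (d + t))   ≡⟨ sym (+-assoc t d (g (d + t))) ⟩
    t + d + g (d + t)     ≡⟨ cong (_+ g (d + t)) (+-comm t d) ⟩
    d + t + g (d + t)     ≡⟨ top ⟨
    g 0                   ∎)
  (subst (λ s → g 0 ≤ t + g s) (+-identityʳ t) (fall g step t 0))
  where open ≤-Reasoning

-- Greedy walkers under a sequence of directions

-- A direction is true for a step along an arc and false for a step against one.
passes : Bool → Letter → Bool
passes true  fwd = true
passes true  bwd = false
passes true  bi  = true
passes false fwd = false
passes false bwd = true
passes false bi  = true

-- The distance covered by a greedy walker that starts in front of edge `j` and crosses the edge
-- ahead whenever the current direction permits it.
run : List Bool → (ℕ → Letter) → ℕ → ℕ
run []      e j = 0
run (s ∷ w) e j = if passes s (e j) then suc (run w e (suc j)) else run w e j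

-- The step preceding that in the direction of a one-way edge cannot cross this
-- edge, but lets every walker standing at a two-way or opposite edge move on.
-- Two-way edges use alternating directions, so that a walker blocked by one of
-- them is let through by the next.
stages : Bool → List Letter → List Bool
stages s []         = []
stages s (fwd ∷ ls) = false ∷ true ∷ stages s ls
stages s (bwd ∷ ls) = true ∷ false ∷ stages s ls
stages s (bi  ∷ ls) = s ∷ stages (not s) ls

price : Letter → ℕ
price fwd = 2
price bwd = 2
price bi  = 1

star# : Letter → ℕ
star# fwd = 0
star# bwd = 0
star# bi  = 1

total : (Letter → ℕ) → (ℕ → Letter) → ℕ → ℕ → ℕ
total c e j zero    = 0
total c e j (suc k) = c (e j) + total c e (suc j) k

-- The unit owed by a walker blocked at a one-way edge which the next two-way
-- stage will let it cross.
data Debt : Bool → Letter → ℕ → Set where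
  none : ∀ {s x} → Debt s x 0
  owed-fwd : Debt true fwd 1
  owed-bwd : Debt false bwd 1

mutual
  -- Each letter of `ls` is charged to an edge that the walker crosses, and one more unit to the
  -- edge in front of which it ends. A two-way stage that fails to move the walker leaves a debt;
  -- the edge responsible is one-way, costs 2 and can pay for the debt as well as for its own unit.
  run-price : ∀ s ls e j {d} → Debt s (e j) d → d + suc (length ls) ≤ total price e j (suc (run (stages s ls) e j))
  run-price s [] e j debt with e j
  run-price s [] e j none     | fwd = s≤s z≤n
  run-price s [] e j owed-fwd | fwd = ≤-refl
  run-price s [] e j none     | bwd = s≤s z≤n
  run-price s [] e j owed-bwd | bwd = ≤-refl
  run-price s [] e j none     | bi  = ≤-refl
  run-price s (fwd ∷ ls) e j debt with e j
  run-price s (fwd ∷ ls) e j none     | fwd = s≤s (m≤n⇒m≤1+n (run-price s ls e (suc j) none))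
  run-price s (fwd ∷ ls) e j owed-fwd | fwd = s≤s (s≤s (run-price s ls e (suc j) none))
  run-price s (fwd ∷ ls) e j none     | bwd = s≤s (m≤n⇒m≤1+n (run-price′ true s ls e (suc j)))
  run-price s (fwd ∷ ls) e j owed-bwd | bwd = s≤s (s≤s (run-price′ true s ls e (suc j)))
  run-price s (fwd ∷ ls) e j none     | bi  = s≤s (run-price′ true s ls e (suc j))
  run-price s (bwd ∷ ls) e j debt with e j
  run-price s (bwd ∷ ls) e j none     | bwd = s≤s (m≤n⇒m≤1+n (run-price s ls e (suc j) none))
  run-price s (bwd ∷ ls) e j owed-bwd | bwd = s≤s (s≤s (run-price s ls e (suc j) none))
  run-price s (bwd ∷ ls) e j none     | fwd = s≤s (m≤n⇒m≤1+n (run-price′ false s ls e (suc j)))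
  run-price s (bwd ∷ ls) e j owed-fwd | fwd = s≤s (s≤s (run-price′ false s ls e (suc j)))
  run-price s (bwd ∷ ls) e j none     | bi  = s≤s (run-price′ false s ls e (suc j))
  run-price true  (bi ∷ ls) e j debt with e j in eq
  run-price true  (bi ∷ ls) e j none     | fwd = s≤s (m≤n⇒m≤1+n (run-price false ls e (suc j) none))
  run-price true  (bi ∷ ls) e j owed-fwd | fwd = s≤s (s≤s (run-price false ls e (suc j) none))
  run-price true  (bi ∷ ls) e j none     | bwd = subst (λ x → 2 + length ls ≤ price x + total price e (suc j) (run (stages false ls) e j)) eq
    (run-price false ls e j (subst (λ x → Debt false x 1) (sym eq) owed-bwd))
  run-price true  (bi ∷ ls) e j none     | bi  = s≤s (run-price false ls e (suc j) none)
  run-price false (bi ∷ ls) e j debt with e j in eq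
  run-price false (bi ∷ ls) e j none     | bwd = s≤s (m≤n⇒m≤1+n (run-price true ls e (suc j) none))
  run-price false (bi ∷ ls) e j owed-bwd | bwd = s≤s (s≤s (run-price true ls e (suc j) none))
  run-price false (bi ∷ ls) e j none     | fwd = subst (λ x → 2 + length ls ≤ price x + total price e (suc j) (run (stages true ls) e j)) eq
    (run-price true ls e j (subst (λ x → Debt true x 1) (sym eq) owed-fwd))
  run-price false (bi ∷ ls) e j none     | bi  = s≤s (run-price true ls e (suc j) none)

  -- The direction `s` is what remains of a two-step stage whose first step has already crossed an
  -- edge. Any further crossing that it yields only adds to the price.
  run-price′ : ∀ s s′ ls e j → suc (length ls) ≤ total price e j (suc (run (s ∷ stages s′ ls) e j))
  run-price′ s s′ ls e j with passes s (e j)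
  ... | true  = ≤-trans (m≤n+m _ (price (e j))) (+-monoʳ-≤ (price (e j)) (run-price s′ ls e (suc j) none))
  ... | false = run-price s′ ls e j none

stars : List Letter → ℕ
stars []       = 0
stars (l ∷ ls) = star# l + stars ls

mutual
  -- A one-way stage contains both directions and so passes an edge with any letter. Only two-way
  -- stages can fail, and `stars` counts these.
  run-length : ∀ s ls e j → length ls ≤ run (stages s ls) e j + stars ls
  run-length s [] e j = z≤n
  run-length s (fwd ∷ ls) e j with e j
  ... | fwd = s≤s (run-length s ls e (suc j))
  ... | bwd = s≤s (run-length′ true s ls e (suc j))
  ... | bi  = s≤s (run-length′ true s ls e (suc j))
  run-length s (bwd ∷ ls) e j with e j
  ... | fwd = s≤s (run-length′ false s ls e (suc j))
  ... | bwd = s≤s (run-length s ls e (suc j))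
  ... | bi  = s≤s (run-length′ false s ls e (suc j))
  run-length s (bi ∷ ls) e j = ≤-trans (s≤s (run-length′ s (not s) ls e j)) (≤-reflexive (sym (+-suc _ (stars ls))))

  run-length′ : ∀ s s′ ls e j → length ls ≤ run (s ∷ stages s′ ls) e j + stars ls
  run-length′ s s′ ls e j with passes s (e j)
  ... | true  = m≤n⇒m≤1+n (run-length s′ ls e (suc j))
  ... | false = run-length s′ ls e j

total-+ : ∀ c e j k l → total c e j (k + l) ≡ total c e j k + total c e (k + j) l
total-+ c e j zero l = refl
total-+ c e j (suc k) l = trans (cong (c (e j) +_) (trans (total-+ c e (suc j) k l)
  (cong (λ i → total c e (suc j) k + total c e i l) (+-suc k j)))) (sym (+-assoc (c (e j)) _ _))

price+star : ∀ e j k → total price e j k + total star# e j k ≡ k + k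
price+star e j zero = refl
price+star e j (suc k) with e j
... | fwd = cong suc (trans (cong suc (price+star e (suc j) k)) (sym (+-suc k k)))
... | bwd = cong suc (trans (cong suc (price+star e (suc j) k)) (sym (+-suc k k)))
... | bi  = cong suc (trans (+-suc _ _) (trans (cong suc (price+star e (suc j) k)) (sym (+-suc k k))))

star≤length : ∀ e j k → total star# e j k ≤ k
star≤length e j zero = z≤n
star≤length e j (suc k) with e j
... | fwd = m≤n⇒m≤1+n (star≤length e (suc j) k)
... | bwd = m≤n⇒m≤1+n (star≤length e (suc j) k)
... | bi  = s≤s (star≤length e (suc j) k)

-- Homomorphisms between powers and the cycle

module Dichotomy (n : ℕ) (3≤n : 3 ≤ n) (W : Word (suc n)) where

  open CyclicOrder n

  V : Set
  V = Fin (suc n)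

  infix 4 _⟶_
  _⟶_ : Rel V 0ℓ
  _⟶_ = CArc W

  Tuple : ℕ → Set
  Tuple = Vec V

  _⟹_ : ∀ {k} → Rel (Tuple k) 0ℓ
  _⟹_ = Pointwise _⟶_

  ⟹-refl : ∀ {k} {xs : Tuple k} → xs ⟹ xs
  ⟹-refl = Pointwise.refl (inj₁ refl)

  ⟶⇒adj : ∀ {u v} → u ⟶ v → Adj u v
  ⟶⇒adj (inj₁ p) = inj₁ p
  ⟶⇒adj (inj₂ (inj₁ (p , _))) = inj₂ (inj₁ p)
  ⟶⇒adj (inj₂ (inj₂ (p , _))) = inj₂ (inj₂ p)

  comparable : ∀ u → u ⟶ next u ⊎ next u ⟶ u
  comparable u with lookup W u
  ... | fwd = inj₁ (inj₂ (inj₁ (refl , plus)))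
  ... | bwd = inj₂ (inj₂ (inj₂ (refl , minus)))
  ... | bi = inj₁ (inj₂ (inj₁ (refl , star)))

  comparable-π : ∀ t → π t ⟶ π (suc t) ⊎ π (suc t) ⟶ π t
  comparable-π t = subst (λ v → π t ⟶ v ⊎ v ⟶ π t) (next-π t) (comparable (π t))

  record Automorphism (σ : V → V) : Set where
    field
      σ-hom   : ∀ {u v} → u ⟶ v → σ u ⟶ σ v
      τ       : V → V
      τ-hom   : ∀ {u v} → u ⟶ v → τ u ⟶ τ v
      inverseˡ : ∀ v → σ (τ v) ≡ v
      inverseʳ : ∀ v → τ (σ v) ≡ v

  -- Composition with the inverse of `σ` reduces this to rigidity of the identity, in the digraph or
  -- in its reverse.
  automorphism-rigid : ∀ {σ} → Automorphism σ → (h : V → V) → (∀ {u v} → u ⟶ v → h u ⟶ h v) →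
                       (∀ {u v} → u ⟶ v → σ u ⟶ h v) ⊎ (∀ {u v} → u ⟶ v → h u ⟶ σ v) →
                       ∀ v → h v ≡ σ v
  automorphism-rigid {σ} A h h-hom near v = trans (sym (inverseˡ (h v))) (cong σ (τ∘h≡id near))
    where
    open Automorphism A
    τ∘h≡id : (∀ {u v} → u ⟶ v → σ u ⟶ h v) ⊎ (∀ {u v} → u ⟶ v → h u ⟶ σ v) → τ (h v) ≡ v
    τ∘h≡id (inj₁ below) = rigid 3≤n _⟶_ (inj₁ refl) ⟶⇒adj comparable (τ ∘ h) (τ-hom ∘ h-hom)
      (λ {u} {w} r → subst (_⟶ τ (h w)) (inverseʳ u) (τ-hom (below r))) v
    τ∘h≡id (inj₂ above) = rigid 3≤n (flip _⟶_) (inj₁ refl) (adj-sym ∘ ⟶⇒adj) (swap ∘ comparable) (τ ∘ h) (τ-hom ∘ h-hom)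
      (λ {u} {w} r → subst (τ (h w) ⟶_) (inverseʳ u) (τ-hom (above r))) v

  -- Such a map is translation by `b`, and n + 1 of these translations add up to a multiple of n +
  -- 1.
  commutes-with-next⇒period : (ρ : V → V) → (∀ v → ρ (next v) ≡ next (ρ v)) → ∀ v → fold v ρ (suc n) ≡ v
  commutes-with-next⇒period ρ comm v = begin
    fold v ρ (suc n)             ≡⟨ cong (λ u → fold u ρ (suc n)) (π-toℕ v) ⟨
    fold (π (toℕ v)) ρ (suc n)   ≡⟨ power (toℕ v) (suc n) ⟩
    π (suc n * b + toℕ v)        ≡⟨ cong π (trans (+-comm (suc n * b) (toℕ v)) (cong (toℕ v +_) (*-comm (suc n) b))) ⟩
    π (toℕ v + b * suc n)        ≡⟨ π-periodic (toℕ v) b ⟩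
    π (toℕ v)                    ≡⟨ π-toℕ v ⟩
    v                            ∎
    where
    open ≡-Reasoning
    b = toℕ (ρ (π 0))
    translation : ∀ j → ρ (π j) ≡ π (b + j)
    translation zero = trans (sym (π-toℕ (ρ (π 0)))) (cong π (sym (+-identityʳ b)))
    translation (suc j) = begin
      ρ (π (suc j))    ≡⟨ cong ρ (next-π j) ⟨
      ρ (next (π j))   ≡⟨ comm (π j) ⟩
      next (ρ (π j))   ≡⟨ cong next (translation j) ⟩
      next (π (b + j)) ≡⟨ next-π (b + j) ⟩
      π (suc (b + j))  ≡⟨ cong π (+-suc b j) ⟨
      π (b + suc j)    ∎
    power : ∀ j k → fold (π j) ρ k ≡ π (k * b + j)
    power j zero = refl
    power j (suc k) = trans (cong ρ (power j k)) (trans (translation (k * b + j)) (cong π (sym (+-assoc b (k * b) j))))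

  -- The square `ρ` of a rotation or reflection commutes with `next`, so its power n + 1 is the
  -- identity. Hence the power 2n + 1 of `σ` is its inverse, and as a power of `σ` it is a
  -- homomorphism.
  dihedral⇒automorphism : (σ : V → V) → (∀ {u v} → u ⟶ v → σ u ⟶ σ v) →
                          (∀ v → σ (next v) ≡ next (σ v)) ⊎ (∀ v → next (σ (next v)) ≡ σ v) → Automorphism σ
  dihedral⇒automorphism σ σ-hom dihedral = record
    { σ-hom = σ-hom
    ; τ = λ v → σ (fold v ρ n)
    ; τ-hom = λ r → σ-hom (fold-hom n r)
    ; inverseˡ = ρ-period
    ; inverseʳ = λ v → trans (cong σ (fold-σ n v)) (ρ-period v)
    }
    where
    ρ = σ ∘ σ
    ρ-comm : (∀ v → σ (next v) ≡ next (σ v)) ⊎ (∀ v → next (σ (next v)) ≡ σ v) → ∀ v → ρ (next v) ≡ next (ρ v)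
    ρ-comm (inj₁ rotation) v = trans (cong σ (rotation v)) (rotation (σ v))
    ρ-comm (inj₂ reflection) v = trans (sym (reflection (σ (next v)))) (cong (next ∘ σ) (reflection v))
    ρ-period = commutes-with-next⇒period ρ (ρ-comm dihedral)
    fold-hom : ∀ k {u v} → u ⟶ v → fold u ρ k ⟶ fold v ρ k
    fold-hom zero r = r
    fold-hom (suc k) r = σ-hom (σ-hom (fold-hom k r))
    fold-σ : ∀ k v → fold (σ v) ρ k ≡ σ (fold v ρ k)
    fold-σ zero v = refl
    fold-σ (suc k) v = cong ρ (fold-σ k v)

  spread : (P : ℕ → Set) → (∀ t → P t → P (suc t)) → (∀ t → P (suc t) → P t) → ∀ i j → P i → P j
  spread P up down i j p = rise j (sink i p)
    where
    sink : ∀ i → P i → P 0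
    sink zero p = p
    sink (suc i) p = sink i (down i p)
    rise : ∀ j → P 0 → P j
    rise zero p = p
    rise (suc j) p = up j (rise j p)

  connected : (P : V → Set) → (∀ {u v} → u ⟶ v ⊎ v ⟶ u → P u → P v) → ∀ u v → P u → P v
  connected P step u v p = subst P (π-toℕ v)
    (spread (P ∘ π) (λ t → step (comparable-π t)) (λ t → step (swap (comparable-π t))) (toℕ u) (toℕ v) (subst P (sym (π-toℕ u)) p))

  tuples-connected : ∀ {k} (P : Tuple k → Set) → (∀ {xs ys} → xs ⟹ ys ⊎ ys ⟹ xs → P xs → P ys) → ∀ xs ys → P xs → P ys
  tuples-connected P step [] [] p = p
  tuples-connected P step (x ∷ xs) (y ∷ ys) p =
    tuples-connected (P ∘ (y ∷_)) (λ { (inj₁ r) → step (inj₁ (inj₁ refl ∷ r)) ; (inj₂ r) → step (inj₂ (inj₁ refl ∷ r)) }) xs ys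
      (connected (λ v → P (v ∷ xs)) (λ { (inj₁ r) → step (inj₁ (r ∷ ⟹-refl)) ; (inj₂ r) → step (inj₂ (r ∷ ⟹-refl)) }) x y p)

  Hom : ∀ {k} → (Tuple k → V) → Set
  Hom {k} f = ∀ {xs ys : Tuple k} → xs ⟹ ys → f xs ⟶ f ys

  record IsLift {k} (f : Tuple k → V) (F : Tuple k → ℕ) : Set where
    field
      over       : ∀ xs → π (F xs) ≡ f xs
      continuous : ∀ {xs ys} → xs ⟹ ys → Within 1 (F xs) (F ys)

  UnaryAutomorphism : ∀ {k} → (Tuple k → V) → Set
  UnaryAutomorphism f = ∃[ i ] ∃[ σ ] (Automorphism σ × (∀ xs → f xs ≡ σ (lookup xs i)))

  -- The representative of `v` next to `i`. The last branch is right only for positive `i` and `v`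
  -- adjacent to `π i`; elsewhere it is a default value.
  move : ℕ → V → ℕ
  move i v with v Fin.≟ π i | v Fin.≟ π (suc i)
  ... | yes _ | _     = i
  ... | no _  | yes _ = suc i
  ... | no _  | no _  = pred i

  π-move : ∀ {i v} → 1 ≤ i → Adj (π i) v → π (move i v) ≡ v
  π-move {suc i} {v} _ a with v Fin.≟ π (suc i) | v Fin.≟ π (suc (suc i))
  ... | yes p | _     = sym p
  ... | no _  | yes q = sym q
  ... | no p  | no q with a
  ...   | inj₁ r = contradiction (sym r) p
  ...   | inj₂ (inj₁ r) = contradiction (trans r (next-π (suc i))) q
  ...   | inj₂ (inj₂ r) = next-injective (trans (next-π i) r)

  move-near : ∀ i v → Within 1 i (move i v)
  move-near i v with v Fin.≟ π i | v Fin.≟ π (suc i)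
  ... | yes _ | _     = n≤1+n i , n≤1+n i
  ... | no _  | yes _ = m≤n+m i 2 , ≤-refl
  move-near zero v    | no _  | no _  = z≤n , z≤n
  move-near (suc i) v | no _  | no _  = ≤-refl , m≤n+m i 2

  -- Dragging a lift once around the first coordinate

  module Monodromy {k} (f : Tuple (suc k) → V) (f-hom : Hom f)
                   (F₀ : Tuple k → ℕ) (F₀-lift : IsLift (f ∘ (π 0 ∷_)) F₀) where

    -- The shift by n + 1 leaves room to descend during the turn, so that the pred
    -- in move never truncates.
    F : ℕ → Tuple k → ℕ
    F zero    xs = F₀ xs + suc n
    F (suc t) xs = move (F t xs) (f (π (suc t) ∷ xs))

    F-step : ∀ t xs → Within 1 (F t xs) (F (suc t) xs)
    F-step t xs = move-near (F t xs) (f (π (suc t) ∷ xs))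

    F-bound : ∀ t xs → suc n ≤ F t xs + t
    F-bound zero xs = ≤-trans (m≤n+m (suc n) (F₀ xs)) (m≤m+n _ 0)
    F-bound (suc t) xs = begin
      suc n                         ≤⟨ F-bound t xs ⟩
      F t xs + t                    ≤⟨ +-monoˡ-≤ t (proj₁ (F-step t xs)) ⟩
      suc (F (suc t) xs) + t        ≡⟨ +-suc (F (suc t) xs) t ⟨
      F (suc t) xs + suc t          ∎
      where open ≤-Reasoning

    F-positive : ∀ {t} → t ≤ n → ∀ xs → 1 ≤ F t xs
    F-positive {t} t≤n xs = +-cancelʳ-≤ t 1 (F t xs) (≤-trans (s≤s t≤n) (F-bound t xs))

    column-adj : ∀ t xs → Adj (f (π t ∷ xs)) (f (π (suc t) ∷ xs))
    column-adj t xs with comparable-π t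
    ... | inj₁ r = ⟶⇒adj (f-hom (r ∷ ⟹-refl))
    ... | inj₂ r = adj-sym (⟶⇒adj (f-hom (r ∷ ⟹-refl)))

    F-over : ∀ {t} → t ≤ suc n → ∀ xs → π (F t xs) ≡ f (π t ∷ xs)
    F-over {zero} _ xs = trans (π-period (F₀ xs)) (IsLift.over F₀-lift xs)
    F-over {suc t} (s≤s t≤n) xs = π-move (F-positive t≤n xs)
      (subst (λ v → Adj v (f (π (suc t) ∷ xs))) (sym (F-over (m≤n⇒m≤1+n t≤n) xs)) (column-adj t xs))

    near-if-adj : ∀ {s t xs ys} → s ≤ suc n → t ≤ suc n → Adj (f (π s ∷ xs)) (f (π t ∷ ys)) →
                  Within 2 (F s xs) (F t ys) → Within 1 (F s xs) (F t ys)
    near-if-adj s≤m t≤m a = adj⇒near 3≤n (subst₂ Adj (sym (F-over s≤m _)) (sym (F-over t≤m _)) a)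

    mutual
      -- The passage from `t` to `suc t` goes through a diagonal arc of the product, available in
      -- the direction of the edge between `π t` and `π (suc t)`. One step along the column and one
      -- between tuples bound each difference by 2, and `near-if-adj` reduces this to 1.
      F-continuous : ∀ {t} → t ≤ suc n → ∀ {xs ys} → xs ⟹ ys → Within 1 (F t xs) (F t ys)
      F-continuous {zero} _ {xs} {ys} r = let p , q = IsLift.continuous F₀-lift r in +-monoˡ-≤ (suc n) p , +-monoˡ-≤ (suc n) q
      F-continuous {suc t} (s≤s t≤n) {xs} {ys} r = near-if-adj (s≤s t≤n) (s≤s t≤n) (⟶⇒adj (f-hom (inj₁ refl ∷ r))) (via (comparable-π t))
        where
        via : π t ⟶ π (suc t) ⊎ π (suc t) ⟶ π t → Within 2 (F (suc t) xs) (F (suc t) ys)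
        via (inj₁ c) = within-trans {1} {1} (within-sym {1} (F-step t xs)) (F-up t≤n c r)
        via (inj₂ c) = within-trans {1} {1} (F-down t≤n c r) (F-step t ys)

      F-up : ∀ {t} → t ≤ n → π t ⟶ π (suc t) → ∀ {xs ys} → xs ⟹ ys → Within 1 (F t xs) (F (suc t) ys)
      F-up t≤n c r = near-if-adj (m≤n⇒m≤1+n t≤n) (s≤s t≤n) (⟶⇒adj (f-hom (c ∷ r)))
        (within-trans {1} {1} (F-continuous (m≤n⇒m≤1+n t≤n) r) (F-step _ _))

      F-down : ∀ {t} → t ≤ n → π (suc t) ⟶ π t → ∀ {xs ys} → xs ⟹ ys → Within 1 (F (suc t) xs) (F t ys)
      F-down t≤n c r = near-if-adj (s≤s t≤n) (m≤n⇒m≤1+n t≤n) (⟶⇒adj (f-hom (c ∷ r)))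
        (within-trans {1} {1} (within-sym {1} (F-step _ _)) (F-continuous (m≤n⇒m≤1+n t≤n) r))

    range : ∀ t xs → Within t (F 0 xs) (F t xs)
    range zero xs = ≤-refl , ≤-refl
    range (suc t) xs = subst (λ d → Within d (F 0 xs) (F (suc t) xs)) (+-comm t 1) (within-trans {t} {1} (range t xs) (F-step t xs))

    π-return : π (suc n) ≡ π 0
    π-return = π-period 0

    same-endpoint : ∀ xs → π (F 0 xs) ≡ π (F (suc n) xs)
    same-endpoint xs = trans (F-over z≤n xs) (trans (cong (λ v → f (v ∷ xs)) (sym π-return)) (sym (F-over ≤-refl xs)))

    -- Both ends of the turn lie over the same vertex, and n + 1 steps separate their values by at
    -- most n + 1.
    trichotomy : ∀ xs → F (suc n) xs ≡ F 0 xs ⊎ F (suc n) xs ≡ suc n + F 0 xs ⊎ F 0 xs ≡ suc n + F (suc n) xs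
    trichotomy xs with range (suc n) xs | ≤-total (F 0 xs) (F (suc n) xs)
    ... | p , q | inj₁ le with F (suc n) xs <? F 0 xs + suc n
    ...   | yes lt = inj₁ (sym (π-injective (same-endpoint xs) le lt))
    ...   | no ge  = inj₂ (inj₁ (≤-antisym q (subst (_≤ F (suc n) xs) (+-comm _ (suc n)) (≮⇒≥ ge))))
    trichotomy xs | p , q | inj₂ le with F 0 xs <? F (suc n) xs + suc n
    ...   | yes lt = inj₁ (π-injective (sym (same-endpoint xs)) le lt)
    ...   | no ge  = inj₂ (inj₂ (≤-antisym p (subst (_≤ F 0 xs) (+-comm _ (suc n)) (≮⇒≥ ge))))

    -- If the displacement vanishes at one tuple, at a neighbouring tuple it is at most 2. Being a
    -- multiple of n + 1, it vanishes there too.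
    closed-everywhere : ∀ xs ys → F (suc n) xs ≡ F 0 xs → F (suc n) ys ≡ F 0 ys
    closed-everywhere = tuples-connected (λ xs → F (suc n) xs ≡ F 0 xs) λ { (inj₁ r) → transfer r ; (inj₂ r) eq → transfer′ r eq }
      where
      conclude : ∀ {xs ys} → Within 1 (F (suc n) xs) (F (suc n) ys) → Within 1 (F 0 xs) (F 0 ys) →
                 F (suc n) xs ≡ F 0 xs → F (suc n) ys ≡ F 0 ys
      conclude {xs} {ys} top bottom eq = π-injective-near 3≤n (sym (same-endpoint ys))
        (within-trans {2} {1} {j = F 0 xs} (m≤n⇒m≤1+n (proj₁ top′) , m≤n⇒m≤1+n (proj₂ top′)) bottom)
        where
        top′ : Within 1 (F (suc n) ys) (F 0 xs)
        top′ = within-sym {1} (subst (λ i → Within 1 i (F (suc n) ys)) eq top)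
      transfer : ∀ {xs ys} → xs ⟹ ys → F (suc n) xs ≡ F 0 xs → F (suc n) ys ≡ F 0 ys
      transfer r = conclude (F-continuous ≤-refl r) (F-continuous z≤n r)
      transfer′ : ∀ {xs ys} → ys ⟹ xs → F (suc n) xs ≡ F 0 xs → F (suc n) ys ≡ F 0 ys
      transfer′ r = conclude (within-sym {1} (F-continuous ≤-refl r)) (within-sym {1} (F-continuous z≤n r))

    module Closed (closed : ∀ xs → F (suc n) xs ≡ F 0 xs) where

      -- At the last vertex the index wraps round to 0, and closedness identifies the two ends of
      -- the turn.
      F-next : ∀ u xs → F (toℕ (next u)) xs ≡ F (suc (toℕ u)) xs
      F-next u xs with m≤n⇒m<n∨m≡n (toℕ<n u)
      ... | inj₁ lt = cong (λ t → F t xs) (trans (toℕ-π (suc (toℕ u))) (m<n⇒m%n≡m lt))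
      ... | inj₂ eq = trans (cong (λ v → F (toℕ v) xs) (trans (cong π eq) π-return))
                            (trans (sym (closed xs)) (cong (λ t → F t xs) (sym eq)))

      toℕ≤n : ∀ (u : V) → toℕ u ≤ n
      toℕ≤n u = ≤-pred (toℕ<n u)

      π-edge : ∀ u → π (suc (toℕ u)) ≡ next u
      π-edge u = trans (sym (next-π (toℕ u))) (cong next (π-toℕ u))

      lift : Tuple (suc k) → ℕ
      lift (v ∷ xs) = F (toℕ v) xs

      isLift : IsLift f lift
      isLift = record { over = over ; continuous = continuous }
        where
        over : ∀ xs → π (lift xs) ≡ f xs
        over (v ∷ xs) = trans (F-over (m≤n⇒m≤1+n (toℕ≤n v)) xs) (cong (λ u → f (u ∷ xs)) (π-toℕ v))
        continuous : ∀ {xs ys} → xs ⟹ ys → Within 1 (lift xs) (lift ys)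
        continuous {u ∷ xs} {_ ∷ ys} (inj₁ refl ∷ r) = F-continuous (m≤n⇒m≤1+n (toℕ≤n u)) r
        continuous {u ∷ xs} {_ ∷ ys} (inj₂ (inj₁ (refl , φ)) ∷ r) = subst (Within 1 (F (toℕ u) xs)) (sym (F-next u ys))
          (F-up (toℕ≤n u) (subst₂ _⟶_ (sym (π-toℕ u)) (sym (π-edge u)) (inj₂ (inj₁ (refl , φ)))) r)
        continuous {_ ∷ xs} {v ∷ ys} (inj₂ (inj₂ (refl , φ)) ∷ r) = subst (λ i → Within 1 i (F (toℕ v) ys)) (sym (F-next v xs))
          (F-down (toℕ≤n v) (subst₂ _⟶_ (sym (π-edge v)) (sym (π-toℕ v)) (inj₂ (inj₂ (refl , φ)))) r)

    module Winding (base : Tuple k) where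

      σ : V → V
      σ v = f (v ∷ base)

      σ-next : ∀ v → σ (next v) ≡ π (F (suc (toℕ v)) base)
      σ-next v = trans (cong σ (trans (cong next (sym (π-toℕ v))) (next-π (toℕ v)))) (sym (F-over (toℕ<n v) base))

      σ-at : ∀ v → σ v ≡ π (F (toℕ v) base)
      σ-at v = trans (cong σ (sym (π-toℕ v))) (sym (F-over (<⇒≤ (toℕ<n v)) base))

      split : ∀ {t} → t ≤ suc n → suc n ∸ t + t ≡ suc n
      split = m∸n+n≡m

      -- A rise of n + 1 in n + 1 steps leaves no step that does not rise by exactly one.
      rotation : F (suc n) base ≡ suc n + F 0 base → ∀ v → σ (next v) ≡ next (σ v)
      rotation top v = begin
        σ (next v)                        ≡⟨ σ-next v ⟩
        π (F (suc (toℕ v)) base)          ≡⟨ cong π (at (toℕ<n v)) ⟩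
        π (suc (toℕ v + F 0 base))        ≡⟨ cong (π ∘ suc) (at (<⇒≤ (toℕ<n v))) ⟨
        π (suc (F (toℕ v) base))          ≡⟨ next-π (F (toℕ v) base) ⟨
        next (π (F (toℕ v) base))         ≡⟨ cong next (σ-at v) ⟨
        next (σ v)                        ∎
        where
        open ≡-Reasoning
        at : ∀ {t} → t ≤ suc n → F t base ≡ t + F 0 base
        at {t} t≤m = steepest-climb (λ t → F t base) (λ t → proj₂ (F-step t base)) {suc n ∸ t} {t}
          (subst (λ s → F s base ≡ s + F 0 base) (sym (split t≤m)) top)

      reflection : F 0 base ≡ suc n + F (suc n) base → ∀ v → next (σ (next v)) ≡ σ v
      reflection top v = begin
        next (σ (next v))                 ≡⟨ cong next (σ-next v) ⟩
        next (π (F (suc (toℕ v)) base))   ≡⟨ next-π (F (suc (toℕ v)) base) ⟩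
        π (suc (F (suc (toℕ v)) base))    ≡⟨ cong π (+-cancelˡ-≡ (toℕ v) _ _ (trans (+-suc (toℕ v) _) (trans (at (toℕ<n v)) (sym (at (<⇒≤ (toℕ<n v))))))) ⟩
        π (F (toℕ v) base)                ≡⟨ σ-at v ⟨
        σ v                               ∎
        where
        open ≡-Reasoning
        at : ∀ {t} → t ≤ suc n → t + F t base ≡ F 0 base
        at {t} t≤m = steepest-fall (λ t → F t base) (λ t → proj₁ (F-step t base)) {suc n ∸ t} {t}
          (subst (λ s → F 0 base ≡ s + F s base) (sym (split t≤m)) top)

      σ-hom : ∀ {u v} → u ⟶ v → σ u ⟶ σ v
      σ-hom r = f-hom (r ∷ ⟹-refl)

      -- An arc between tuples makes the lines over them comparable as homomorphisms, so
      -- `automorphism-rigid` carries the equality with `σ` from each tuple to its neighbours.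
      unary : Automorphism σ → UnaryAutomorphism f
      unary A = Fin.zero , σ , A , λ { (v ∷ xs) → tuples-connected (λ xs → ∀ v → f (v ∷ xs) ≡ σ v) spread-out base xs (λ _ → refl) v }
        where
        spread-out : ∀ {xs ys : Tuple k} → xs ⟹ ys ⊎ ys ⟹ xs → (∀ v → f (v ∷ xs) ≡ σ v) → ∀ v → f (v ∷ ys) ≡ σ v
        spread-out {xs} {ys} (inj₁ r) eq = automorphism-rigid A (λ v → f (v ∷ ys)) (λ c → f-hom (c ∷ ⟹-refl))
          (inj₁ λ {u} {v} c → subst (_⟶ f (v ∷ ys)) (eq u) (f-hom (c ∷ r)))
        spread-out {xs} {ys} (inj₂ r) eq = automorphism-rigid A (λ v → f (v ∷ ys)) (λ c → f-hom (c ∷ ⟹-refl))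
          (inj₂ λ {u} {v} c → subst (f (u ∷ ys) ⟶_) (eq v) (f-hom (c ∷ r)))

    lift-or-unary : ∃ (IsLift f) ⊎ UnaryAutomorphism f
    lift-or-unary with trichotomy base
      where base = replicate k (π 0)
    ... | inj₁ eq = inj₁ (_ , Closed.isLift (λ xs → closed-everywhere _ xs eq))
    ... | inj₂ (inj₁ eq) = inj₂ (unary (dihedral⇒automorphism σ σ-hom (inj₁ (rotation eq))))
      where open Winding (replicate k (π 0))
    ... | inj₂ (inj₂ eq) = inj₂ (unary (dihedral⇒automorphism σ σ-hom (inj₂ (reflection eq))))
      where open Winding (replicate k (π 0))

  -- Induction on the arity

  update-⟹ : ∀ {k} {u v} (xs : Tuple k) i → u ⟶ v → (xs [ i ]≔ u) ⟹ (xs [ i ]≔ v)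
  update-⟹ (x ∷ xs) Fin.zero r = r ∷ ⟹-refl
  update-⟹ (x ∷ xs) (Fin.suc i) r = inj₁ refl ∷ update-⟹ xs i r

  -- Here rigidity acts along coordinate `i` instead of the first one: an arc between two values of
  -- the first coordinate makes the corresponding lines in direction `i` comparable.
  unary-extends : ∀ {k} (f : Tuple (suc k) → V) → Hom f → UnaryAutomorphism (f ∘ (π 0 ∷_)) → UnaryAutomorphism f
  unary-extends f f-hom (i , σ , A , base) =
    Fin.suc i , σ , A , λ { (v ∷ xs) → connected (λ v → ∀ xs → f (v ∷ xs) ≡ σ (lookup xs i)) spread-out (π 0) v base xs }
    where
    spread-out : ∀ {u v} → u ⟶ v ⊎ v ⟶ u → (∀ xs → f (u ∷ xs) ≡ σ (lookup xs i)) → ∀ xs → f (v ∷ xs) ≡ σ (lookup xs i)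
    -- Writing `xs` as an update of itself at `i` turns the slice into a map of that coordinate
    -- alone.
    spread-out {u} {v} c eq xs = trans (cong (λ ys → f (v ∷ ys)) (sym ([]≔-lookup xs i)))
      (automorphism-rigid A (λ w → f (v ∷ (xs [ i ]≔ w))) (λ r → f-hom (inj₁ refl ∷ update-⟹ xs i r)) (near c) (lookup xs i))
      where
      eq′ : ∀ w → f (u ∷ (xs [ i ]≔ w)) ≡ σ w
      eq′ w = trans (eq (xs [ i ]≔ w)) (cong σ (lookup∘updateAt i xs))
      near : u ⟶ v ⊎ v ⟶ u → (∀ {a b} → a ⟶ b → σ a ⟶ f (v ∷ (xs [ i ]≔ b))) ⊎ (∀ {a b} → a ⟶ b → f (v ∷ (xs [ i ]≔ a)) ⟶ σ b)
      near (inj₁ c) = inj₁ λ {a} {b} r → subst (_⟶ f (v ∷ (xs [ i ]≔ b))) (eq′ a) (f-hom (c ∷ update-⟹ xs i r))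
      near (inj₂ c) = inj₂ λ {a} {b} r → subst (f (v ∷ (xs [ i ]≔ a)) ⟶_) (eq′ b) (f-hom (c ∷ update-⟹ xs i r))

  dichotomy : ∀ k (f : Tuple k → V) → Hom f → ∃ (IsLift f) ⊎ UnaryAutomorphism f
  -- A nullary map is a single vertex, and any representative lifts it.
  dichotomy zero f f-hom = inj₁ ((λ _ → toℕ (f [])) , record
    { over = λ { [] → π-toℕ (f []) }
    ; continuous = λ _ → n≤1+n _ , n≤1+n _
    })
  dichotomy (suc k) f f-hom with dichotomy k (f ∘ (π 0 ∷_)) (λ r → f-hom (inj₁ refl ∷ r))
  ... | inj₁ (F₀ , F₀-lift) = Monodromy.lift-or-unary f f-hom F₀ F₀-lift
  ... | inj₂ U = inj₂ (unary-extends f f-hom U)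

-- Walks with prescribed directions

module Walks (n : ℕ) (3≤n : 3 ≤ n) (W : Word (suc n)) where

  open CyclicOrder n
  open Dichotomy n 3≤n W

  ℓ : ℕ → Letter
  ℓ i = lookup W (π i)

  letters : ℕ → ℕ → List Letter
  letters a zero    = []
  letters a (suc k) = ℓ a ∷ letters (suc a) k

  letters-cong : ∀ {a b} k → π a ≡ π b → letters a k ≡ letters b k
  letters-cong zero eq = refl
  letters-cong {a} {b} (suc k) eq = cong₂ _∷_ (cong (lookup W) eq)
    (letters-cong k (trans (sym (next-π a)) (trans (cong next eq) (next-π b))))

  module Walk {A : Set} (R : Rel A 0ℓ) where

    Step : Bool → Rel A 0ℓ
    Step true  u v = R u v
    Step false u v = R v u

    Walk : List Bool → Rel A 0ℓ
    Walk []      u v = u ≡ v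
    Walk (s ∷ w) u v = ∃[ z ] (Step s u z × Walk w z v)

  open Walk

  -- Walks in different coordinates can be run simultaneously because they share one sequence of
  -- directions, and hence their length.
  walk-product : ∀ {k} w {xs ys : Tuple k} → Pointwise (Walk _⟶_ w) xs ys → Walk _⟹_ w xs ys
  walk-product [] [] = refl
  walk-product [] (refl ∷ ps) = cong (_ ∷_) (walk-product [] ps)
  walk-product (s ∷ w) ps = let zs , first , rest = unzip s w ps in zs , first , walk-product w rest
    where
    unzip : ∀ {k} s w {xs ys : Tuple k} → Pointwise (Walk _⟶_ (s ∷ w)) xs ys → ∃[ zs ] (Step _⟹_ s xs zs × Pointwise (Walk _⟶_ w) zs ys)
    unzip true w [] = [] , [] , []
    unzip false w [] = [] , [] , []
    unzip true w ((z , r , p) ∷ ps) = let zs , rs , qs = unzip true w ps in z ∷ zs , r ∷ rs , p ∷ qs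
    unzip false w ((z , r , p) ∷ ps) = let zs , rs , qs = unzip false w ps in z ∷ zs , r ∷ rs , p ∷ qs

  stay : ∀ s {v} → Step _⟶_ s v v
  stay true = inj₁ refl
  stay false = inj₁ refl

  step-up : ∀ s i → passes s (ℓ i) ≡ true → Step _⟶_ s (π i) (π (suc i))
  step-up s i ok with lookup W (π i) in eq
  step-up true i ok | fwd = inj₂ (inj₁ (sym (next-π i) , subst HasForward (sym eq) plus))
  step-up true i ok | bi = inj₂ (inj₁ (sym (next-π i) , subst HasForward (sym eq) star))
  step-up false i ok | bwd = inj₂ (inj₂ (sym (next-π i) , subst HasBackward (sym eq) minus))
  step-up false i ok | bi = inj₂ (inj₂ (sym (next-π i) , subst HasBackward (sym eq) star))

  step-down : ∀ s i → passes s (opposite (ℓ i)) ≡ true → Step _⟶_ s (π (suc i)) (π i)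
  step-down s i ok with lookup W (π i) in eq
  step-down false i ok | fwd = inj₂ (inj₁ (sym (next-π i) , subst HasForward (sym eq) plus))
  step-down false i ok | bi = inj₂ (inj₁ (sym (next-π i) , subst HasForward (sym eq) star))
  step-down true i ok | bwd = inj₂ (inj₂ (sym (next-π i) , subst HasBackward (sym eq) minus))
  step-down true i ok | bi = inj₂ (inj₂ (sym (next-π i) , subst HasBackward (sym eq) star))

  stay-put : ∀ w v → Walk _⟶_ w v v
  stay-put [] v = refl
  stay-put (s ∷ w) v = v , stay s , stay-put w v

  -- A greedy walker may stop early and spend the remaining directions on loops, so every distance
  -- up to its range is attained.
  walk-up : ∀ w j t → t ≤ run w ℓ j → Walk _⟶_ w (π j) (π (t + j))
  walk-up w j zero _ = stay-put w (π j)
  walk-up (s ∷ w) j (suc t) le with passes s (ℓ j) in eq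
  ... | true  = π (suc j) , step-up s j eq , subst (Walk _⟶_ w (π (suc j)) ∘ π) (+-suc t j) (walk-up w (suc j) t (≤-pred le))
  ... | false = π j , stay s , walk-up w j (suc t) le

  -- The edges below `c` as a descending walker meets them, each seen from its upper end. Because of
  -- truncated subtraction this is meaningful only for `j` below `c`.
  mirror : ℕ → ℕ → Letter
  mirror c j = opposite (ℓ (c ∸ suc j))

  walk-down : ∀ c w j t → t + j ≤ c → t ≤ run w (mirror c) j → Walk _⟶_ w (π (c ∸ j)) (π (c ∸ (t + j)))
  walk-down c w j zero _ _ = stay-put w (π (c ∸ j))
  walk-down c (s ∷ w) j (suc t) room le with passes s (mirror c j) in eq
  ... | false = π (c ∸ j) , stay s , walk-down c w j (suc t) room le
  ... | true  = π (c ∸ suc j)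
      , subst (λ i → Step _⟶_ s (π i) (π (c ∸ suc j))) (sym (∸-suc-lemma (≤-trans (s≤s (m≤n+m j t)) room))) (step-down s (c ∸ suc j) eq)
      , subst (Walk _⟶_ w (π (c ∸ suc j)) ∘ π ∘ (c ∸_)) (+-suc t j)
          (walk-down c w (suc j) t (subst (_≤ c) (sym (+-suc t j)) room) (≤-pred le))
    where
    ∸-suc-lemma : ∀ {c j} → j < c → c ∸ j ≡ suc (c ∸ suc j)
    ∸-suc-lemma {suc c} (s≤s j≤c) = +-∸-assoc 1 j≤c

  π≢π-suc : ∀ i → π i ≢ π (suc i)
  π≢π-suc i eq = contradiction (π-injective-near 3≤n eq (m≤n+m i 4 , m≤n+m (suc i) 2)) (<⇒≢ ≤-refl)

  π≢π-suc² : ∀ i → π i ≢ π (2 + i)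
  π≢π-suc² i eq = contradiction (π-injective-near 3≤n eq (m≤n+m i 5 , m≤n+m (2 + i) 1)) (<⇒≢ (m≤n+m (suc i) 1))

  forward-edge : ∀ i → π i ⟶ π (suc i) → HasForward (ℓ i)
  forward-edge i (inj₁ eq) = contradiction eq (π≢π-suc i)
  forward-edge i (inj₂ (inj₁ (_ , φ))) = φ
  forward-edge i (inj₂ (inj₂ (eq , _))) = contradiction (trans eq (next-π (suc i))) (π≢π-suc² i)

  backward-edge : ∀ i → π (suc i) ⟶ π i → HasBackward (ℓ i)
  backward-edge i (inj₁ eq) = contradiction (sym eq) (π≢π-suc i)
  backward-edge i (inj₂ (inj₁ (eq , _))) = contradiction (trans eq (next-π (suc i))) (π≢π-suc² i)
  backward-edge i (inj₂ (inj₂ (_ , φ))) = φ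

  edge-passes : ∀ s i → Step _⟶_ s (π i) (π (suc i)) → passes s (ℓ i) ≡ true
  edge-passes true i r with lookup W (π i) | forward-edge i r
  ... | fwd | plus = refl
  ... | bi  | star = refl
  edge-passes false i r with lookup W (π i) | backward-edge i r
  ... | bwd | minus = refl
  ... | bi  | star = refl

  -- Growth of a lift along a walk

  module Lifted {k} (f : Tuple k → V) (f-hom : Hom f) (F : Tuple k → ℕ) (F-lift : IsLift f F) where

    open IsLift F-lift

    step-near : ∀ s {xs ys} → Step _⟹_ s xs ys → F ys ≤ suc (F xs)
    step-near true r = proj₂ (continuous r)
    step-near false r = proj₁ (continuous r)

    step-hom : ∀ s {xs ys} → Step _⟹_ s xs ys → Step _⟶_ s (f xs) (f ys)
    step-hom true r = f-hom r
    step-hom false r = f-hom r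

    -- Exceeding the ceiling `a` would require a step from value `a` to value `suc a`, which `f`
    -- would map to the edge `a` in a direction that its letter forbids.
    step-blocked : ∀ s a {xs ys} → passes s (ℓ a) ≡ false → Step _⟹_ s xs ys → F xs ≤ a → F ys ≤ a
    step-blocked s a {xs} {ys} blocked r le with F ys ≤? a
    ... | yes p = p
    ... | no ¬p = contradiction (trans (sym blocked) (edge-passes s a (subst₂ (Step _⟶_ s) (at le₁) (at le₂) (step-hom s r)))) λ ()
      where
      le₁ : F xs ≡ a
      le₁ = ≤-antisym le (≤-pred (≤-trans (≰⇒> ¬p) (step-near s r)))
      le₂ : F ys ≡ suc a
      le₂ = ≤-antisym (≤-trans (step-near s r) (s≤s le)) (≰⇒> ¬p)
      at : ∀ {zs i} → F zs ≡ i → f zs ≡ π i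
      at {zs} eq = trans (sym (over zs)) (cong π eq)

    step-once : ∀ s {a xs ys} → Step _⟹_ s xs ys → F xs ≤ a → F ys ≤ suc a
    step-once s r le = ≤-trans (step-near s r) (s≤s le)

    -- Each stage raises the ceiling by one. The first step of a one-way stage cannot cross the edge
    -- at the ceiling, so only its second step counts; a two-way stage has a single step.
    walk-bound : ∀ s k a {xs ys} → F xs ≤ a → Walk _⟹_ (stages s (letters a k)) xs ys → F ys ≤ k + a
    walk-bound s zero a le refl = le
    walk-bound s (suc k) a {xs} {ys} le p = subst (F ys ≤_) (+-suc k a) (first p)
      where
      first : Walk _⟹_ (stages s (letters a (suc k))) xs ys → F ys ≤ k + suc a
      first p with ℓ a in eq
      first (_ , r , _ , r′ , p) | fwd = walk-bound s k (suc a) (step-once true r′ (step-blocked false a (cong (passes false) eq) r le)) p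
      first (_ , r , _ , r′ , p) | bwd = walk-bound s k (suc a) (step-once false r′ (step-blocked true a (cong (passes true) eq) r le)) p
      first (_ , r , p)          | bi  = walk-bound (not s) k (suc a) (step-once s r le) p

  -- Together the upward and the downward walker reach all n vertices other than their start. The
  -- start is shifted by a turn to leave room below it, and the quantifiers range over residues so
  -- that the property can be decided by evaluation.
  Covering : Set
  Covering = ∀ a c → n ≤ run (w a) ℓ (toℕ {suc n} c + suc n) + run (w a) (mirror (toℕ c + suc n)) 0
    where
    w : V → List Bool
    w a = stages true (letters (toℕ a) (pred n))

  covering⇒walk : Covering → ∀ i u v → Walk _⟶_ (stages true (letters i (pred n))) u v
  covering⇒walk covering i u v = subst₂ (λ u v → Walk _⟶_ w u v) (trans (π-period (toℕ u)) (π-toℕ u)) (trans at-t+c (π-toℕ v)) walk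
    where
    w = stages true (letters i (pred n))
    c = toℕ u + suc n
    -- The upward distance from `u` to `v`, reduced modulo n + 1.
    t = toℕ (π (toℕ v + (suc n ∸ toℕ u)))
    u≤m : toℕ u ≤ suc n
    u≤m = <⇒≤ (toℕ<n u)
    at-t+c : π (t + c) ≡ π (toℕ v)
    at-t+c = begin
      π (t + c)                                       ≡⟨ cong π (+-comm t c) ⟩
      π (c + t)                                       ≡⟨ π-+-toℕ c _ ⟩
      π (c + (toℕ v + (suc n ∸ toℕ u)))               ≡⟨ cong π (begin
        toℕ u + suc n + (toℕ v + (suc n ∸ toℕ u))     ≡⟨ +-comm c _ ⟩
        toℕ v + (suc n ∸ toℕ u) + (toℕ u + suc n)     ≡⟨ +-assoc (toℕ v) _ c ⟩
        toℕ v + ((suc n ∸ toℕ u) + (toℕ u + suc n))   ≡⟨ cong (toℕ v +_) (sym (+-assoc (suc n ∸ toℕ u) (toℕ u) (suc n))) ⟩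
        toℕ v + ((suc n ∸ toℕ u) + toℕ u + suc n)     ≡⟨ cong (λ i → toℕ v + (i + suc n)) (m∸n+n≡m u≤m) ⟩
        toℕ v + (suc n + suc n)                       ≡⟨ cong (λ i → toℕ v + (suc n + i)) (sym (+-identityʳ (suc n))) ⟩
        toℕ v + 2 * suc n                             ∎) ⟩
      π (toℕ v + 2 * suc n)                           ≡⟨ π-periodic (toℕ v) 2 ⟩
      π (toℕ v)                                       ∎
      where open ≡-Reasoning
    enough : n ≤ run w ℓ c + run w (mirror c) 0
    enough = subst (λ ls → n ≤ run (stages true ls) ℓ c + run (stages true ls) (mirror c) 0)
      (letters-cong (pred n) (π-toℕ (π i))) (covering (π i) u)
    walk : Walk _⟶_ w (π c) (π (t + c))
    walk with t ≤? run w ℓ c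
    ... | yes le = walk-up w c t le
    -- The complementary distance `t′` is covered downwards: `t` exceeds the upward range, and the
    -- two ranges add up to at least n.
    ... | no gt = subst (Walk _⟶_ w (π c)) around (walk-down c w 0 t′ (subst (_≤ c) (sym (+-identityʳ t′)) (≤-trans t′≤m (m≤n+m (suc n) (toℕ u)))) t′-reached)
      where
      t≤m : t ≤ suc n
      t≤m = <⇒≤ (toℕ<n (π (toℕ v + (suc n ∸ toℕ u))))
      t′ = suc n ∸ t
      t′≤m : t′ ≤ suc n
      t′≤m = m∸n≤m (suc n) t
      t′-reached : t′ ≤ run w (mirror c) 0
      t′-reached = +-cancelˡ-≤ (run w ℓ c) _ _ (≤-trans (≤-pred (begin
        suc (run w ℓ c + t′)  ≤⟨ +-monoˡ-≤ t′ (≰⇒> gt) ⟩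
        t + (suc n ∸ t)       ≡⟨ m+[n∸m]≡n t≤m ⟩
        suc n                 ∎)) enough)
        where open ≤-Reasoning
      around : π (c ∸ (t′ + 0)) ≡ π (t + c)
      around = begin
        π (c ∸ (t′ + 0))        ≡⟨ cong (λ i → π (c ∸ i)) (+-identityʳ t′) ⟩
        π (c ∸ t′)              ≡⟨ cong π (+-∸-assoc (toℕ u) t′≤m) ⟩
        π (toℕ u + (suc n ∸ t′)) ≡⟨ cong (λ i → π (toℕ u + i)) (m∸[m∸n]≡n t≤m) ⟩
        π (toℕ u + t)           ≡⟨ π-period (toℕ u + t) ⟨
        π (toℕ u + t + suc n)   ≡⟨ cong π (begin
          toℕ u + t + suc n     ≡⟨ cong (_+ suc n) (+-comm (toℕ u) t) ⟩
          t + toℕ u + suc n     ≡⟨ +-assoc t (toℕ u) (suc n) ⟩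
          t + c                 ∎) ⟩
        π (t + c)               ∎
        where open ≡-Reasoning

  covering⇒¬liftable : Covering → ∀ {k} (f : Tuple k → V) → Hom f → StrictlySurjective _≡_ f → ¬ ∃ (IsLift f)
  covering⇒¬liftable covering {k} f f-hom surj (F , F-lift) = <-rec (λ i → ∀ xs → F xs ≢ i) no-minimum _ origin refl
    where
    open IsLift F-lift
    origin = proj₁ (surj (π 0))
    walks : ∀ i xs ys → Walk _⟹_ (stages true (letters i (pred n))) xs ys
    walks i xs ys = walk-product _ (everywhere xs ys)
      where
      everywhere : ∀ {k} (xs ys : Tuple k) → Pointwise (Walk _⟶_ (stages true (letters i (pred n)))) xs ys
      everywhere [] [] = []
      everywhere (x ∷ xs) (y ∷ ys) = covering⇒walk covering i x y ∷ everywhere xs ys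
    no-minimum : ∀ i → (∀ {j} → j < i → ∀ xs → F xs ≢ j) → ∀ xs → F xs ≢ i
    -- The residue of `F xs + n` is the one just below the minimum. The values of `F` lie from
    -- `F xs` up to `F xs + n`, the upper end excluded, and none of these numbers has that residue.
    no-minimum i smaller xs refl with surj (π (F xs + n))
    ... | ys , fy = contradiction i+n≤Fys (<⇒≱ Fys<i+n)
      where
      minimal : F xs ≤ F ys
      minimal = ≮⇒≥ λ lt → smaller lt ys refl
      Fys<i+n : F ys < F xs + n
      Fys<i+n = ≤-trans (s≤s (Lifted.walk-bound f f-hom F F-lift true (pred n) (F xs) ≤-refl (walks (F xs) xs ys)))
        (≤-reflexive (trans (cong (_+ F xs) (suc-pred n {{>-nonZero (≤-trans (s≤s z≤n) 3≤n)}})) (+-comm n (F xs))))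
      i+n≤Fys : F xs + n ≤ F ys
      i+n≤Fys = ≤-reflexive (sym (π-injective (trans (over ys) fy) (<⇒≤ Fys<i+n)
        (≤-trans (≤-reflexive (sym (+-suc (F xs) n))) (+-monoˡ-≤ (suc n) minimal))))

  -- Counting prices and two-way edges around the cycle

  total-mirror : ∀ c k j → k + j ≤ c → total price (mirror c) j k ≡ total price ℓ (c ∸ (k + j)) k
  total-mirror c zero j _ = refl
  total-mirror c (suc k) j room = begin
    price (mirror c j) + total price (mirror c) (suc j) k
      ≡⟨ cong₂ _+_ (price-opposite (ℓ (c ∸ suc j))) (total-mirror c k (suc j) (subst (_≤ c) (sym (+-suc k j)) room)) ⟩
    price (ℓ (c ∸ suc j)) + total price ℓ (c ∸ (k + suc j)) k
      ≡⟨ +-comm (price (ℓ (c ∸ suc j))) _ ⟩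
    total price ℓ (c ∸ (k + suc j)) k + price (ℓ (c ∸ suc j))
      ≡⟨ cong₂ (λ a b → total price ℓ (c ∸ a) k + price (ℓ b)) (+-suc k j) (sym end) ⟩
    total price ℓ b k + price (ℓ (k + b))
      ≡⟨ cong (total price ℓ b k +_) (sym (+-identityʳ _)) ⟩
    total price ℓ b k + total price ℓ (k + b) 1
      ≡⟨ total-+ price ℓ b k 1 ⟨
    total price ℓ b (k + 1)
      ≡⟨ cong (total price ℓ b) (+-comm k 1) ⟩
    total price ℓ b (suc k) ∎
    where
    open ≡-Reasoning
    b = c ∸ (suc k + j)
    price-opposite : ∀ x → price (opposite x) ≡ price x
    price-opposite fwd = refl
    price-opposite bwd = refl
    price-opposite bi  = refl
    end : k + b ≡ c ∸ suc j
    end = begin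
      k + (c ∸ (suc k + j))   ≡⟨ cong (λ i → k + (c ∸ i)) (trans (sym (+-suc k j)) (+-comm k (suc j))) ⟩
      k + (c ∸ (suc j + k))   ≡⟨ cong (k +_) (sym (∸-+-assoc c (suc j) k)) ⟩
      k + (c ∸ suc j ∸ k)     ≡⟨ m+[n∸m]≡n (m+n≤o⇒m≤o∸n k (subst (_≤ c) (sym (+-suc k j)) room)) ⟩
      c ∸ suc j               ∎

  star#W : ℕ
  star#W = total star# ℓ 0 (suc n)

  -- Shifting the window by one drops edge `b` and adds edge `suc n + b`, which is the same edge of
  -- the cycle.
  total-rotate : ∀ b → total star# ℓ b (suc n) ≡ star#W
  total-rotate zero = refl
  total-rotate (suc b) = trans (+-cancelˡ-≡ (star# (ℓ b)) _ _ (begin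
    star# (ℓ b) + total star# ℓ (suc b) (suc n)              ≡⟨ cong (total star# ℓ b) (+-comm (suc n) 1) ⟨
    total star# ℓ b (suc n + 1)                              ≡⟨ total-+ star# ℓ b (suc n) 1 ⟩
    total star# ℓ b (suc n) + (star# (ℓ (suc n + b)) + 0)    ≡⟨ cong (total star# ℓ b (suc n) +_) (+-identityʳ _) ⟩
    total star# ℓ b (suc n) + star# (ℓ (suc n + b))          ≡⟨ +-comm (total star# ℓ b (suc n)) _ ⟩
    star# (ℓ (suc n + b)) + total star# ℓ b (suc n)          ≡⟨ cong (λ v → star# (lookup W v) + total star# ℓ b (suc n)) (trans (cong π (+-comm (suc n) b)) (π-period b)) ⟩
    star# (ℓ b) + total star# ℓ b (suc n)                    ∎)) (total-rotate b)
    where open ≡-Reasoning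

  window-split : ∀ b {k} → k ≤ suc n → star#W ≡ total star# ℓ b k + total star# ℓ (k + b) (suc n ∸ k)
  window-split b {k} k≤m = trans (sym (total-rotate b)) (trans (cong (total star# ℓ b) (sym (m+[n∸m]≡n k≤m))) (total-+ star# ℓ b k (suc n ∸ k)))

  length-letters : ∀ a k → length (letters a k) ≡ k
  length-letters a zero = refl
  length-letters a (suc k) = cong suc (length-letters (suc a) k)

  stars-letters : ∀ a k → stars (letters a k) ≡ total star# ℓ a k
  stars-letters a zero = refl
  stars-letters a (suc k) = cong (star# (ℓ a) +_) (stars-letters (suc a) k)

  suc-pred-n : suc (pred n) ≡ n
  suc-pred-n = suc-pred n {{>-nonZero (≤-trans (s≤s z≤n) 3≤n)}}

  -- If the ranges add up to less than n, the edges crossed and the two edges at which the walkers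
  -- end form a window of `k` distinct edges, with k at most n + 1. By `run-price` its price is at
  -- least 2n. Price and stars of the window add up to 2k, and at most n + 1 - k stars lie outside,
  -- so 2n plus the number of stars is at most k + n + 1, hence at most 2n + 2.
  three-stars⇒covering : 3 ≤ star#W → Covering
  three-stars⇒covering 3≤stars a v = ≮⇒≥ λ short → <⇒≱ 3≤stars (at-most-two short)
    where
    open ≤-Reasoning
    ls = letters (toℕ a) (pred n)
    c = toℕ v + suc n
    u = run (stages true ls) ℓ c
    d = run (stages true ls) (mirror c) 0
    k = suc d + suc u
    b = c ∸ suc d
    paid : ∀ e j → n ≤ total price e j (suc (run (stages true ls) e j))
    paid e j = subst (_≤ total price e j (suc (run (stages true ls) e j))) (trans (cong suc (length-letters (toℕ a) (pred n))) suc-pred-n) (run-price true ls e j none)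
    at-most-two : u + d < n → star#W ≤ 2
    at-most-two short = +-cancelˡ-≤ (n + n) _ _ (begin
      n + n + star#W                                                  ≤⟨ +-monoˡ-≤ star#W (+-mono-≤ (paid (mirror c) 0) (paid ℓ c)) ⟩
      total price (mirror c) 0 (suc d) + total price ℓ c (suc u) + star#W ≡⟨ cong (_+ star#W) joined ⟩
      total price ℓ b k + star#W                                      ≡⟨ cong (total price ℓ b k +_) (window-split b k≤m) ⟩
      total price ℓ b k + (total star# ℓ b k + total star# ℓ (k + b) (suc n ∸ k)) ≡⟨ +-assoc (total price ℓ b k) _ _ ⟨
      total price ℓ b k + total star# ℓ b k + total star# ℓ (k + b) (suc n ∸ k) ≡⟨ cong (_+ total star# ℓ (k + b) (suc n ∸ k)) (price+star ℓ b k) ⟩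
      k + k + total star# ℓ (k + b) (suc n ∸ k)                       ≤⟨ +-monoʳ-≤ (k + k) (star≤length ℓ (k + b) (suc n ∸ k)) ⟩
      k + k + (suc n ∸ k)                                             ≡⟨ +-assoc k k (suc n ∸ k) ⟩
      k + (k + (suc n ∸ k))                                           ≡⟨ cong (k +_) (m+[n∸m]≡n k≤m) ⟩
      k + suc n                                                       ≤⟨ +-monoˡ-≤ (suc n) k≤m ⟩
      suc n + suc n                                                   ≡⟨ cong suc (+-suc n n) ⟩
      2 + (n + n)                                                     ≡⟨ +-comm 2 (n + n) ⟩
      n + n + 2                                                       ∎)
      where
      k≤m : k ≤ suc n
      k≤m = s≤s (≤-trans (≤-reflexive (trans (+-suc d u) (cong suc (+-comm d u)))) short)
      d<c : suc d ≤ c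
      d<c = ≤-trans (m+n≤o⇒m≤o (suc d) k≤m) (m≤n+m (suc n) (toℕ v))
      joined : total price (mirror c) 0 (suc d) + total price ℓ c (suc u) ≡ total price ℓ b k
      joined = trans (cong₂ _+_
        (trans (total-mirror c (suc d) 0 (≤-trans (≤-reflexive (+-identityʳ (suc d))) d<c)) (cong (λ i → total price ℓ (c ∸ i) (suc d)) (+-identityʳ (suc d))))
        (cong (λ i → total price ℓ i (suc u)) (sym (m+[n∸m]≡n d<c))))
        (sym (total-+ price ℓ b (suc d) (suc u)))

  -- At most two of the n - 1 stages can fail, so each walker covers at least n - 3 edges, and 2(n -
  -- 3) is at least n once n is at least 6.
  two-stars⇒covering : star#W ≤ 2 → 6 ≤ n → Covering
  two-stars⇒covering stars≤2 6≤n a v = +-cancelʳ-≤ 4 n (u + d) (begin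
    n + 4                ≡⟨ cong (_+ 4) suc-pred-n ⟨
    suc (pred n) + 4     ≡⟨ +-suc (pred n) 4 ⟨
    pred n + 5           ≤⟨ +-monoʳ-≤ (pred n) (pred-mono-≤ 6≤n) ⟩
    pred n + pred n      ≤⟨ +-mono-≤ (reached ℓ c) (reached (mirror c) 0) ⟩
    (u + 2) + (d + 2)    ≡⟨ +-assoc u 2 (d + 2) ⟩
    u + (2 + (d + 2))    ≡⟨ cong (u +_) (trans (+-comm 2 (d + 2)) (+-assoc d 2 2)) ⟩
    u + (d + 4)          ≡⟨ +-assoc u d 4 ⟨
    u + d + 4            ∎)
    where
    open ≤-Reasoning
    ls = letters (toℕ a) (pred n)
    c = toℕ v + suc n
    u = run (stages true ls) ℓ c
    d = run (stages true ls) (mirror c) 0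
    stars-ls : stars ls ≤ 2
    stars-ls = begin
      stars ls                           ≡⟨ stars-letters (toℕ a) (pred n) ⟩
      total star# ℓ (toℕ a) (pred n)     ≤⟨ m≤m+n _ _ ⟩
      total star# ℓ (toℕ a) (pred n) + _ ≡⟨ window-split (toℕ a) (≤-trans (n≤1+n _) (≤-trans (≤-reflexive suc-pred-n) (n≤1+n n))) ⟨
      star#W                             ≤⟨ stars≤2 ⟩
      2                                  ∎
    reached : ∀ e j → pred n ≤ run (stages true ls) e j + 2
    reached e j = begin
      pred n                                ≡⟨ length-letters (toℕ a) (pred n) ⟨
      length ls                             ≤⟨ run-length true ls e j ⟩
      run (stages true ls) e j + stars ls   ≤⟨ +-monoʳ-≤ _ stars-ls ⟩
      run (stages true ls) e j + 2          ∎

  covering⇒słupecki : Covering → Słupecki (C W)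
  covering⇒słupecki covering k _ f f-hom surj with dichotomy k f f-hom
  ... | inj₁ lift = contradiction lift (covering⇒¬liftable covering f f-hom surj)
  ... | inj₂ (i , σ , A , eq) = i , σ , Automorphism.σ-hom A , eq

open Walks

-- Self-dual words of each length

total-star≡count : ∀ {k} (V : Word k) e j → (∀ i → e (toℕ i + j) ≡ lookup V i) → total star# e j k ≡ count (Defs._≟_ bi) V
total-star≡count [] e j h = refl
total-star≡count (x ∷ V) e j h with e j | h Fin.zero
... | .x | refl with x | total-star≡count V e (suc j) (λ i → trans (cong e (+-suc (toℕ i) j)) (h (Fin.suc i)))
...   | fwd | ih = ih
...   | bwd | ih = ih
...   | bi  | ih = cong suc ih

count-∷ʳ-fwd : ∀ {k} (P : Word k) → count (Defs._≟_ bi) (P ∷ʳ fwd) ≡ count (Defs._≟_ bi) P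
count-∷ʳ-fwd [] = refl
count-∷ʳ-fwd (fwd ∷ P) = count-∷ʳ-fwd P
count-∷ʳ-fwd (bwd ∷ P) = count-∷ʳ-fwd P
count-∷ʳ-fwd (bi ∷ P) = cong suc (count-∷ʳ-fwd P)

star#W≡count : ∀ n 3≤n (P : Word n) → star#W n 3≤n (P ∷ʳ fwd) ≡ count (Defs._≟_ bi) P
star#W≡count n 3≤n P = trans (total-star≡count (P ∷ʳ fwd) _ 0 (λ i → cong (lookup (P ∷ʳ fwd))
  (trans (cong (CyclicOrder.π n) (+-identityʳ (toℕ i))) (CyclicOrder.π-toℕ n i)))) (count-∷ʳ-fwd P)

self-opposite : ∀ {x} → x ≡ opposite x → x ≡ bi
self-opposite {fwd} ()
self-opposite {bwd} ()
self-opposite {bi} _ = refl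

-- In a self-dual word of odd length the middle letter is its own opposite and hence two-way, while
-- the other stars come in pairs. Their number is therefore odd, and two stars imply a third; the
-- same reason serves length 5.
length-3⇒three-stars : (P : Word 3) → SelfDual P → 2 ≤ count (Defs._≟_ bi) P → 3 ≤ count (Defs._≟_ bi) P
length-3⇒three-stars (x ∷ y ∷ z ∷ []) dual 2≤count
  with refl ← self-opposite (cong (λ P → lookup P (Fin.suc Fin.zero)) dual)
     | refl ← cong (λ P → lookup P (Fin.suc (Fin.suc Fin.zero))) dual = cases x 2≤count
  where
  cases : ∀ x → 2 ≤ count (Defs._≟_ bi) (x ∷ bi ∷ opposite x ∷ []) → 3 ≤ count (Defs._≟_ bi) (x ∷ bi ∷ opposite x ∷ [])
  cases fwd (s≤s ())
  cases bwd (s≤s ())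
  cases bi  _ = ≤-refl

length-5⇒three-stars : (P : Word 5) → SelfDual P → 2 ≤ count (Defs._≟_ bi) P → 3 ≤ count (Defs._≟_ bi) P
length-5⇒three-stars (x ∷ y ∷ z ∷ y′ ∷ x′ ∷ []) dual 2≤count
  with refl ← self-opposite (cong (λ P → lookup P (Fin.suc (Fin.suc Fin.zero))) dual)
     | refl ← cong (λ P → lookup P (Fin.suc (Fin.suc (Fin.suc Fin.zero)))) dual
     | refl ← cong (λ P → lookup P (Fin.suc (Fin.suc (Fin.suc (Fin.suc Fin.zero))))) dual = cases x y 2≤count
  where
  cases : ∀ x y → 2 ≤ count (Defs._≟_ bi) (x ∷ y ∷ bi ∷ opposite y ∷ opposite x ∷ []) →
          3 ≤ count (Defs._≟_ bi) (x ∷ y ∷ bi ∷ opposite y ∷ opposite x ∷ [])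
  cases fwd fwd (s≤s ())
  cases fwd bwd (s≤s ())
  cases fwd bi  _ = ≤-refl
  cases bwd fwd (s≤s ())
  cases bwd bwd (s≤s ())
  cases bwd bi  _ = ≤-refl
  cases bi  fwd _ = ≤-refl
  cases bi  bwd _ = ≤-refl
  cases bi  bi  _ = m≤n+m 3 2

3≤4 : 3 ≤ 4
3≤4 = n≤1+n 3

covering? : (P : Word 4) → Dec (Covering 4 3≤4 (P ∷ʳ fwd))
covering? P = Fin.all? λ a → Fin.all? λ c → 4 ≤? _

-- The price estimate needs three stars, and the cruder length estimate n ≥ 6;
-- the remaining two-star words, all of length 4, are checked by evaluation.
length-4⇒covering : (P : Word 4) → SelfDual P → 2 ≤ count (Defs._≟_ bi) P → Covering 4 3≤4 (P ∷ʳ fwd)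
length-4⇒covering (x ∷ y ∷ y′ ∷ x′ ∷ []) dual 2≤count
  with refl ← cong (λ P → lookup P (Fin.suc (Fin.suc Fin.zero))) dual
     | refl ← cong (λ P → lookup P (Fin.suc (Fin.suc (Fin.suc Fin.zero)))) dual = cases x y 2≤count
  where
  cases : ∀ x y → 2 ≤ count (Defs._≟_ bi) (x ∷ y ∷ opposite y ∷ opposite x ∷ []) →
          Covering 4 3≤4 (x ∷ y ∷ opposite y ∷ opposite x ∷ fwd ∷ [])
  cases fwd fwd ()
  cases fwd bwd ()
  cases bwd fwd ()
  cases bwd bwd ()
  cases fwd bi  _ = from-yes (covering? (fwd ∷ bi ∷ bi ∷ bwd ∷ []))
  cases bwd bi  _ = from-yes (covering? (bwd ∷ bi ∷ bi ∷ fwd ∷ []))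
  cases bi  fwd _ = from-yes (covering? (bi ∷ fwd ∷ bwd ∷ bi ∷ []))
  cases bi  bwd _ = from-yes (covering? (bi ∷ bwd ∷ fwd ∷ bi ∷ []))
  cases bi  bi  _ = from-yes (covering? (bi ∷ bi ∷ bi ∷ bi ∷ []))

many-stars⇒covering : ∀ {n} 3≤n (P : Word n) → 3 ≤ count (Defs._≟_ bi) P → Covering n 3≤n (P ∷ʳ fwd)
many-stars⇒covering 3≤n P 3≤count = three-stars⇒covering _ 3≤n (P ∷ʳ fwd) (subst (3 ≤_) (sym (star#W≡count _ 3≤n P)) 3≤count)

self-dual⇒covering : ∀ n (P : Word n) → (3≤n : 3 ≤ n) → SelfDual P → 2 ≤ count (Defs._≟_ bi) P → Covering n 3≤n (P ∷ʳ fwd)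
self-dual⇒covering 1 P (s≤s ())
self-dual⇒covering 2 P (s≤s (s≤s ()))
self-dual⇒covering 3 P 3≤n dual 2≤count = many-stars⇒covering 3≤n P (length-3⇒three-stars P dual 2≤count)
self-dual⇒covering 4 P 3≤n dual 2≤count = subst (λ p → Covering 4 p (P ∷ʳ fwd)) (≤-irrelevant 3≤4 3≤n) (length-4⇒covering P dual 2≤count)
self-dual⇒covering 5 P 3≤n dual 2≤count = many-stars⇒covering 3≤n P (length-5⇒three-stars P dual 2≤count)
self-dual⇒covering (suc (suc (suc (suc (suc (suc n)))))) P 3≤n dual 2≤count with count (Defs._≟_ bi) P ≤? 2
... | yes ≤2 = two-stars⇒covering _ 3≤n (P ∷ʳ fwd) (subst (_≤ 2) (sym (star#W≡count _ 3≤n P)) ≤2) (m≤m+n 6 n)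
... | no ≰2 = many-stars⇒covering 3≤n P (≰⇒> ≰2)

open Defs using (+; *; _≟_)

theorem5p4 : ∀ (n : ℕ) (P : Word n) → 3 ≤ n → SelfDual P → 2 ≤ count (* ≟_) P → Słupecki (C (P ∷ʳ +))
theorem5p4 n P 3≤n dual 2≤count = covering⇒słupecki n 3≤n (P ∷ʳ fwd) (self-dual⇒covering n P 3≤n dual 2≤count)
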